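{- For the problem FindValue (defined in the context), there is a randomized distributed algorithm which is $\frac{23}{16}$-competitive against an adaptive, offline adversary, while no deterministic distributed algorithm for FindValue is $c$-competitive for any $c<\frac32$ (i.e. the best deterministic algorithm is no better than $\frac32$-competitive).
   Context: The problem FindValue. There are $3$ processes $p_0,p_1,p_2$ in a synchronous distributed system. Each process $p_i$ has one single-writer register $R_i$ (only $p_i$ writes to it, every process may read it). The processes communicate only by writing to and reading from these registers. In each round, each process can flip some coins (if the algorithm is randomized) and, based on its state and the outcomes of its coin tosses, it can do nothing, write to its own register, or read the register of some other process. From time to time, an adversary gives a number as input to one of the processes and lets it take a step, in which it appends a pair consisting of its process id and this number to its register. In the next round, the adversary notifies each of the other two processes that it has produced a new number (by giving a special notification input), but does not tell them to whom it gave this number. The goal is for each process to write the entire sequence of pairs into its own single-writer register. The cost (complexity measure) is the number of register reads that are performed by the processes trying to find the numbers. The optimal offline algorithm OPT knows which process received the number; each of the two notified processes performs exactly one read (of the register of the process that received the number), so OPT has cost exactly $2$ per input number. Competitiveness. A deterministic algorithm ALG is $c$-competitive if there is a constant $\alpha$ such that for all input sequences $I$ generated by the adversary, $\mathrm{ALG}(I)\le c\,\mathrm{OPT}(I)+\alpha$. A randomized algorithm is $c$-competitive against an adaptive, offline adversary if the same inequality holds for the expected costs, when the adversary may choose each next input depending on all the actions and coin-toss outcomes of the algorithm so far, and the adversary's own cost is the optimal offline cost OPT on the resulting input sequence. -}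

module Defs where

open import Data.Bool.Base using (Bool; true; false)
open import Data.Fin.Base using (Fin)
open import Data.Fin.Properties using (_≟_)
open import Data.Integer.Base using (+_)
open import Data.List.Base using (List; []; _∷_; _∷ʳ_; map; filter; concatMap; length; allFin)
open import Data.Maybe.Base using (Maybe; just; nothing)
open import Data.Nat.Base as ℕ using (ℕ; zero; suc)
open import Data.Nat.ListAction using (sum)
open import Data.Product.Base using (Σ; ∃; _×_; _,_; proj₁)
open import Data.Rational.Base using (ℚ; ½; _/_; _+_; _*_; _≤_)
open import Data.Unit.Base using (⊤)
open import Data.Vec.Base using (Vec; []; _∷_; lookup)
open import Relation.Binary.PropositionalEquality using (_≡_; _≢_)
open import Relation.Nullary.Decidable using (yes; no; does; ¬?)

Proc : Set
Proc = Fin 3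

-- (i , v): the number v is given to process i.  This is also the pair which
-- process i appends to its register.
Input : Set
Input = Proc × ℕ

-- A process may write any list of pairs into its register, so a register can
-- temporarily carry information other than the sequence of inputs.
Register : Set
Register = List Input

-- What process i, with local states in S, does in one round.  A read supplies
-- the contents of the register to the computation of the new state.
data Action (S : Set) (i : Proc) : Set where
  skip  : S → Action S i
  write : Register → S → Action S i
  read  : (j : Proc) → j ≢ i → (Register → S) → Action S i

-- An algorithm in which each process is offered k fair coin tosses per round
-- (it may ignore them).  The Bool argument says whether the process is
-- notified, in this round, of an input given to another process in the
-- previous round.  `receive` is the change of state in a round in which the
-- process itself is given a number; its step is then the forced append.
record Algorithm (k : ℕ) : Set₁ where
  field
    State   : Set
    init    : Proc → State
    step    : (i : Proc) → State → Bool → Vec Bool k → Action State i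
    receive : (i : Proc) → State → Bool → Vec Bool k → ℕ → State

DeterministicAlgorithm : Set₁
DeterministicAlgorithm = Algorithm 0

-- Component i holds the coin tosses of process i in one round.
Coins : ℕ → Set
Coins k = Vec (Vec Bool k) 3

-- One round: the adversary's move, if any, and all coin tosses.
Round : ℕ → Set
Round k = Maybe Input × Coins k

-- Rounds are listed most recent first.  Given the algorithm, a history
-- determines every action taken so far.
History : ℕ → Set
History k = List (Round k)

-- The input sequence of a history, oldest input first.
inputs : ∀ {k} → History k → List Input
inputs []                  = []
inputs ((nothing , _) ∷ h) = inputs h
inputs ((just x  , _) ∷ h) = inputs h ∷ʳ x

-- The history h followed by t rounds without input, with coin tosses ω.
idle : ∀ {k} → (ℕ → Coins k) → ℕ → History k → History k
idle ω zero    h = h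
idle ω (suc t) h = (nothing , ω t) ∷ idle ω t h

module Execution {k : ℕ} (A : Algorithm k) where
  open Algorithm A

  record Config : Set where
    field
      state     : Proc → State
      register  : Proc → Register
      lastInput : Maybe Proc  -- the process given a number in the previous round
      reads     : ℕ           -- register reads performed so far
  open Config public

  initial : Config
  initial = record
    { state     = init
    ; register  = λ _ → []
    ; lastInput = nothing
    ; reads     = 0
    }

  notified : Config → Proc → Bool
  notified C i with lastInput C
  ... | nothing = false
  ... | just j  = does (¬? (j ≟ i))

  record Effect : Set where
    constructor effect
    field
      newState    : State
      newRegister : Register
      readCount   : ℕ
  open Effect public

  -- Reads return the contents of registers at the beginning of the round.
  perform : Config → (i : Proc) → Action State i → Effect
  perform C i (skip s)        = effect s (register C i) 0
  perform C i (write R s)     = effect s R 0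
  perform C i (read j _ cont) = effect (cont (register C j)) (register C i) 1

  ordinaryStep : Config → Coins k → Proc → Effect
  ordinaryStep C c i =
    perform C i (step i (state C i) (notified C i) (lookup c i))

  localStep : Config → Round k → Proc → Effect
  localStep C (nothing      , c) i = ordinaryStep C c i
  localStep C (just (j , v) , c) i with j ≟ i
  ... | yes _ = effect (receive i (state C i) (notified C i) (lookup c i) v)
                       (register C i ∷ʳ (i , v)) 0
  ... | no  _ = ordinaryStep C c i

  receiver : Maybe Input → Maybe Proc
  receiver nothing        = nothing
  receiver (just (i , _)) = just i

  next : Config → Round k → Config
  next C r = record
    { state     = λ i → newState (localStep C r i)
    ; register  = λ i → newRegister (localStep C r i)
    ; lastInput = receiver (proj₁ r)
    ; reads     = reads C ℕ.+ sum (map (λ i → readCount (localStep C r i)) (allFin 3))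
    }

  run : History k → Config
  run []      = initial
  run (r ∷ h) = next (run h) r

  cost : History k → ℕ
  cost h = reads (run h)

  Done : History k → Set
  Done h = ∀ i → register (run h) i ≡ inputs h

-- The (reader , register) pairs for the reads of OPT on one input.
optReads : Input → List (Proc × Proc)
optReads (i , _) = map (λ q → (q , i)) (filter (λ q → ¬? (q ≟ i)) (allFin 3))

opt : List Input → ℕ
opt I = length (concatMap optReads I)

-- When the adversary may give the next number: in any round, or only in rounds
-- at whose beginning all registers contain the entire sequence so far.
data Timing : Set where
  anytime sequential : Timing

MayInput : ∀ {k} → Timing → Algorithm k → History k → Set
MayInput anytime    A h = ⊤
MayInput sequential A h = Execution.Done A h

module _ {k : ℕ} (τ : Timing) (A : Algorithm k) where
  open Execution A

  data Allowed : History k → Set where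
    start : Allowed []
    wait  : ∀ {h c} → Allowed h → Allowed ((nothing , c) ∷ h)
    give  : ∀ {h x c} → MayInput τ A h → Allowed h → Allowed ((just x , c) ∷ h)

  -- Whatever the (finite) input sequence and the coin tosses, from some round
  -- on every register contains the entire sequence.  Containing it in a single
  -- round would not be enough: blind enumeration of all sequences does that.
  Solves : Set
  Solves = ∀ h → Allowed h → (ω : ℕ → Coins k) →
           ∃ λ T → ∀ t → T ℕ.≤ t → Done (idle ω t h)

  -- An adaptive adversary: its move in a round depends on everything that
  -- happened before that round.
  record Adversary : Set where
    field
      move  : History k → Maybe Input
      legal : ∀ h x → move h ≡ just x → MayInput τ A h

averageBits : (n : ℕ) → (Vec Bool n → ℚ) → ℚ
averageBits zero    f = f []
averageBits (suc n) f = ½ * (averageBits n (λ b → f (true ∷ b)) + averageBits n (λ b → f (false ∷ b)))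

averageCoins : (k n : ℕ) → (Vec (Vec Bool k) n → ℚ) → ℚ
averageCoins k zero    f = f []
averageCoins k (suc n) f = averageBits k (λ b → averageCoins k n (λ c → f (b ∷ c)))

-- The expected value of X after T further rounds, starting from history h,
-- against an adversary moving according to σ.
expectation : ∀ {k} → (History k → Maybe Input) → (History k → ℚ) → ℕ → History k → ℚ
expectation     σ X zero    h = X h
expectation {k} σ X (suc T) h =
  averageCoins k 3 (λ c → expectation σ X T ((σ h , c) ∷ h))

fromℕ : ℕ → ℚ
fromℕ n = + n / 1

-- In both definitions below, bounding the cost of every finite execution is
-- the same as bounding the total cost on every finite input sequence: reads
-- only accumulate, and any execution can be continued without further input.

DeterministicallyCompetitive : Timing → DeterministicAlgorithm → ℚ → Set
DeterministicallyCompetitive τ A c =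
  Σ ℚ λ α → ∀ h → Allowed τ A h →
    fromℕ (cost h) ≤ c * fromℕ (opt (inputs h)) + α
  where open Execution A

-- Competitiveness against adaptive, offline adversaries.
CompetitiveInExpectation : ∀ {k} → Timing → Algorithm k → ℚ → Set
CompetitiveInExpectation τ A c =
  Σ ℚ λ α → ∀ (adv : Adversary τ A) (T : ℕ) →
    let open Adversary adv in
    expectation move (λ h → fromℕ (cost h)) T [] ≤
    c * expectation move (λ h → fromℕ (opt (inputs h))) T [] + α
  where open Execution A

{-# OPTIONS --safe #-}

-- Upper bound.  Process 0 is a hub.  After an input which it did not receive,
-- it learns the number by reading registers 1 and 2 in a random order, stopping
-- as soon as nothing is missing, and publishes the whole sequence; the others
-- then read register 0.  Undisturbed, this takes at most 1 + 1/2 + 1 = 5/2 reads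
-- on average, that is a ratio of 5/4.  An adversary interrupting the protocol
-- restarts it; the slack up to 23/16 pays for the reads made in vain, as an
-- amortised analysis over a finite abstraction of the configurations shows.
--
-- Lower bound.  Until it reads, a notified process behaves in the same way
-- whoever received the number.  Let k be the first process to read in this
-- situation and j the process it reads from.  If the number is given to the
-- third process, then that read reveals nothing, so k reads at least twice and j
-- at least once.
module Submission where

open import Defs
open import Data.Bool.Base using (Bool; true; false; T; if_then_else_; _∧_; _∨_; not)
open import Data.Bool.ListAction using (all)
open import Data.Bool.Properties using (T?)
open import Data.Empty using (⊥-elim)
open import Data.Fin.Base using (Fin; suc)
open import Data.Fin.Patterns
open import Data.Fin.Properties using (_≟_; all?)
open import Data.Integer.Base as ℤ using (+_)
import Data.Integer.Properties as ℤ
import Data.Integer.Solver as ℤ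
open import Data.List.Base using (List; []; _∷_; _∷ʳ_; map; zipWith)
import Data.List.Properties as List
open import Data.List.Relation.Binary.Pointwise as Pointwise using (Pointwise; []; _∷_)
open import Data.Maybe.Base as Maybe using (Maybe; just; nothing; fromMaybe; maybe; is-just)
import Data.Maybe.Properties as Maybe
open import Data.Nat.Base as ℕ using (ℕ; zero; suc; z≤n; s≤s)
import Data.Nat.Properties as ℕ
import Data.Nat.Solver as ℕ
open import Data.Product.Base using (Σ; ∃; ∃₂; _×_; _,_; proj₁; proj₂)
open import Data.Rational.Base
open import Data.Rational.Properties hiding (_≟_)
open import Data.Rational.Solver using (module +-*-Solver)
import Data.Rational.Unnormalised.Base as ℚᵘ
import Data.Rational.Unnormalised.Properties as ℚᵘ
open import Data.Sum.Base using (_⊎_; inj₁; inj₂)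
open import Data.Unit.Base using (tt)
open import Data.Vec.Base using (Vec; []; _∷_; lookup; tabulate; _[_]≔_; head; replicate)
open import Data.Vec.Properties using (lookup∘tabulate; lookup∘updateAt; lookup∘updateAt′)
open import Function.Base using (_∘_; case_of_)
open import Relation.Binary.PropositionalEquality
open import Relation.Nullary.Decidable using (Dec; yes; no; does; ¬?; map′; toWitness; _×-dec_; _→-dec_)
open import Relation.Nullary.Negation.Core using (¬_; contradiction)
open import Relation.Unary using (Decidable)

-- The hub algorithm.

-- The number of rounds since the last input, up to 7.
Stage : Set
Stage = Fin 8

later : Stage → Stage
later 0F = 1F
later 1F = 2F
later 2F = 3F
later 3F = 4F
later 4F = 5F
later 5F = 6F
later 6F = 7F
later 7F = 7F

-- A process knows how many inputs there were, from the notifications; an input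
-- is `nothing` while the process does not know it.
Known : Set
Known = List (Maybe Input)

-- Once the sequence is complete this is the sequence itself.  An unknown input is
-- written as a pair with tag 0, which nobody reading register 1 or 2 trusts.
publish : Known → Register
publish = map (fromMaybe (0F , 0))

complete : Known → Bool
complete = all is-just

-- Whether a reader of register j believes a pair with tag t: register 0 is read
-- only when it is complete, and register j > 0 is relied upon only for the inputs
-- of process j.
trusts : Proc → Proc → Bool
trusts 0F _ = true
trusts j  t = does (j ≟ t)

-- Entries are matched by position, which is meaningful because an up-to-date register holds one
-- pair per input, placeholders included.
absorb : Proc → Known → Register → Known
absorb j = zipWith (λ m x → if trusts j (proj₁ x) then just x else m)

Target : Proc → Set
Target i = ∃ λ j → j ≢ i

-- A coin showing false skips the first read, so that register 2 comes before
-- register 1.  In this way no memory of the coin is needed.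
leaderPlan : Stage → Bool → Maybe (Target 0F)
leaderPlan 1F true = just (1F , λ ())
leaderPlan 2F _    = just (2F , λ ())
leaderPlan 3F _    = just (1F , λ ())
leaderPlan _  _    = nothing

-- Process 0 has finished reading by stage 3 and publishes in stage 4, so its register shows the
-- whole sequence at the beginning of stage 5.
followerPlan : Stage → ∀ i → Maybe (Target (suc i))
followerPlan 5F _ = just (0F , λ ())
followerPlan _  _ = nothing

plan : Stage → Bool → (i : Proc) → Maybe (Target i)
plan s b 0F          = leaderPlan s b
plan s b (suc i) = followerPlan s i

act : (i : Proc) → Stage × Known → Bool → Action (Stage × Known) i
act i (s , K) b with plan s b i | complete K
... | just (j , j≢i) | false = read j j≢i (λ R → later s , absorb j K R)
-- This is the early stop: a planned read is dropped once nothing is missing.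
... | just _         | true  = write (publish K) (later s , K)
... | nothing        | _     = write (publish K) (later s , K)

-- A notification takes effect before the process acts, so in the round after an input all three
-- processes are in stage 0.
tick : Bool → Stage × Known → Stage × Known
tick true  (_ , K) = 0F , K ∷ʳ nothing
tick false V       = V

hub : Algorithm 1
hub = record
  { State   = Stage × Known
  ; init    = λ _ → 7F , []
  ; step    = λ i V b c → act i (tick b V) (head c)
  -- The forced append may go to an outdated register; therefore every process republishes in stage
  -- 0, before any read of a later stage.
  ; receive = λ i V b _ v → 0F , proj₂ (tick b V) ∷ʳ just (i , v)
  }

-- Masks: a finite abstraction of what the processes know.

Mask : Set
Mask = Vec Bool 3

-- The mask bounds from above the set of processes with an unknown input.
data Entry (M : Mask) : Maybe Input → Input → Set where
  known : ∀ {x} → Entry M (just x) x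
  hole  : ∀ {x} → lookup M (proj₁ x) ≡ true → Entry M nothing x

Partial : Mask → Known → List Input → Set
Partial M = Pointwise (Entry M)

isEmpty : Mask → Bool
isEmpty M = not (lookup M 0F ∨ lookup M 1F ∨ lookup M 2F)

isEmpty-sound : ∀ M → T (isEmpty M) → ∀ t → lookup M t ≡ false
isEmpty-sound (false ∷ false ∷ false ∷ []) _ 0F = refl
isEmpty-sound (false ∷ false ∷ false ∷ []) _ 1F = refl
isEmpty-sound (false ∷ false ∷ false ∷ []) _ 2F = refl

true-false-absurd : ∀ {b} → b ≡ true → b ≡ false → ∀ {A : Set} → A
true-false-absurd refl ()

publish-full : ∀ {M K I} → T (isEmpty M) → Partial M K I → publish K ≡ I
publish-full e [] = refl
publish-full e (known ∷ p) = cong (_ ∷_) (publish-full e p)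
publish-full {M} e (_∷_ {y = x} (hole h) p) = true-false-absurd h (isEmpty-sound M e (proj₁ x))

complete-full : ∀ {M K I} → T (isEmpty M) → Partial M K I → complete K ≡ true
complete-full e [] = refl
complete-full e (known ∷ p) = complete-full e p
complete-full {M} e (_∷_ {y = x} (hole h) p) = true-false-absurd h (isEmpty-sound M e (proj₁ x))

-- Masks are only upper bounds. A process that in fact knows everything writes where the abstraction
-- assumes a read, and this lemma still justifies the mask after that read.
full-partial : ∀ {M N K I} → complete K ≡ true → Partial M K I → Partial N K I
full-partial c []          = []
full-partial c (known ∷ p) = known ∷ full-partial c p

weaken : ∀ {M N K I} → (∀ t → lookup M t ≡ true → lookup N t ≡ true) → Partial M K I → Partial N K I
weaken f = Pointwise.map λ { known → known ; (hole h) → hole (f _ h) }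

afterRead : Maybe Proc → Mask → Mask
afterRead nothing  M = M
afterRead (just j) M = tabulate λ t → lookup M t ∧ not (trusts j t)

-- A hole of the register's owner is harmful if its placeholder, tagged 0, would be believed, or if
-- the reader relies on the owner for that input. Hence register 0 must have no holes, and register
-- j > 0 none among the inputs of j.
readable : Proc → Mask → Bool
readable j L = isEmpty (tabulate λ t → lookup L t ∧ (trusts j 0F ∨ trusts j t))

untrusted : ∀ j L t → T (readable j L) → lookup L t ≡ true → trusts j 0F ≡ false × trusts j t ≡ false
untrusted j L t ok h with isEmpty-sound (tabulate λ t → lookup L t ∧ (trusts j 0F ∨ trusts j t)) ok t
... | e rewrite lookup∘tabulate (λ t → lookup L t ∧ (trusts j 0F ∨ trusts j t)) t | h with trusts j 0F | trusts j t
... | false | false = refl , refl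

-- A trusted pair is genuine, since `readable` excludes holes there; an untrusted pair leaves the
-- reader's entry as it was, and the mask keeps the corresponding process.
absorb-partial : ∀ {M L K K′ I} j → T (readable j L) → Partial M K I → Partial L K′ I →
                 Partial (afterRead (just j) M) (absorb j K (publish K′)) I
absorb-partial j ok [] [] = []
absorb-partial {M} {L} {I = x ∷ _} j ok (e ∷ p) (e′ ∷ p′) = entry e e′ ∷ absorb-partial j ok p p′
  where
  kept : ∀ {m} → trusts j (proj₁ x) ≡ false → Entry M m x → Entry (afterRead (just j) M) m x
  kept u known    = known
  kept u (hole h) = hole (trans (lookup∘tabulate (λ t → lookup M t ∧ not (trusts j t)) (proj₁ x)) (cong₂ (λ a b → a ∧ not b) h u))
  entry : ∀ {m m′} → Entry M m x → Entry L m′ x →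
          Entry (afterRead (just j) M) (if trusts j (proj₁ (fromMaybe (0F , 0) m′)) then just (fromMaybe (0F , 0) m′) else m) x
  entry e known with trusts j (proj₁ x) in u
  ... | true  = known
  ... | false = kept u e
  entry e (hole h) with untrusted j L (proj₁ x) ok h
  ... | u₀ , u = subst (λ b → Entry (afterRead (just j) M) (if b then just (0F , 0) else _) x) (sym u₀) (kept u e)

readsOf : Maybe Proc → Mask → ℕ
readsOf nothing  M = 0
readsOf (just _) M = if isEmpty M then 0 else 1

-- Whether register i is sure to contain what process i published last.
fresh : Stage → Proc → Bool
fresh 0F _  = false
fresh 2F 0F = false
fresh 3F 0F = false
fresh 4F 0F = false
fresh 6F (suc _) = false
fresh _  _  = true

Masks : Set
Masks = Vec Mask 3

-- An invariant of the abstract configurations that occur, starting from stage 7.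
good : Stage → Masks → Bool
good s (M₀ ∷ M₁ ∷ M₂ ∷ []) =
  not (lookup M₀ 0F) ∧ not (lookup M₁ 1F) ∧ not (lookup M₂ 2F) ∧ atStage s
  where
  atStage : Stage → Bool
  atStage 3F = not (lookup M₀ 2F)
  atStage 4F = isEmpty M₀
  atStage 5F = isEmpty M₀
  atStage 6F = isEmpty M₀ ∧ isEmpty M₁ ∧ isEmpty M₂
  atStage 7F = isEmpty M₀ ∧ isEmpty M₁ ∧ isEmpty M₂
  atStage _  = true

target : Stage → Bool → Proc → Maybe Proc
target s b i = Maybe.map proj₁ (plan s b i)

stageStep : Maybe Proc → Stage → Stage
stageStep nothing  s = later s
stageStep (just _) s = 0F

-- The receiver's step is the forced append, so its planned read does not happen; the other
-- processes still act before the new hole appears.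
maskStep : Maybe Proc → Maybe Proc → Proc → Mask → Mask
maskStep nothing  g i M = afterRead g M
maskStep (just j) g i M = if does (j ≟ i) then M else afterRead g M [ j ]≔ true

readStep : Maybe Proc → Maybe Proc → Proc → Mask → ℕ
readStep nothing  g i M = readsOf g M
readStep (just j) g i M = if does (j ≟ i) then 0 else readsOf g M

masksStep : Maybe Proc → Bool → Stage → Masks → Masks
masksStep mv b s m = tabulate λ i → maskStep mv (target s b i) i (lookup m i)

readsStep : Maybe Proc → Bool → Stage → Masks → ℕ
readsStep mv b s m = r 0F ℕ.+ (r 1F ℕ.+ (r 2F ℕ.+ 0))
  where
  r : Proc → ℕ
  r i = readStep mv (target s b i) i (lookup m i)

-- Debts and the amortised inequality.

-- Debts are sixteenths of expected future reads.  In stages 0 and 1 the order of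
-- the reads of process 0 is still random: a single missing register costs 3/2.
leaderDebt : Stage → Bool → Bool → ℕ
leaderDebt 0F true  true  = 32
leaderDebt 0F true  false = 24
leaderDebt 0F false true  = 24
leaderDebt 1F true  true  = 32
leaderDebt 1F true  false = 24
leaderDebt 1F false true  = 24
leaderDebt 2F true  _     = 32
leaderDebt 2F false true  = 16
leaderDebt 3F true  _     = 16
leaderDebt _  _     _     = 0

debt : Stage → Masks → ℕ
debt s m = leaderDebt s (lookup (lookup m 0F) 1F) (lookup (lookup m 0F) 2F) ℕ.+
  (followerDebt (lookup m 1F) ℕ.+ followerDebt (lookup m 2F))
  where
  followerDebt : Mask → ℕ
  followerDebt M = if isEmpty M then 0 else 16

credit : Maybe Proc → ℕ
credit = maybe (λ _ → 2) 0

-- The abstract configurations are finitely many, so the amortised inequality is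
-- decided by evaluation.
allBool? : ∀ {P : Bool → Set} → Decidable P → Dec (∀ b → P b)
allBool? P? = map′ (λ { (f , t) → λ { false → f ; true → t } }) (λ h → h false , h true)
  (P? false ×-dec P? true)

allVec? : ∀ {A : Set} → (∀ {P : A → Set} → Decidable P → Dec (∀ a → P a)) →
          ∀ n {P : Vec A n → Set} → Decidable P → Dec (∀ v → P v)
allVec? all zero    P? = map′ (λ { p [] → p }) (λ h → h []) (P? [])
allVec? all (suc n) P? = map′ (λ { h (a ∷ v) → h a v }) (λ h a v → h (a ∷ v))
  (all λ a → allVec? all n λ v → P? (a ∷ v))

allMaybe? : ∀ {A : Set} → (∀ {P : A → Set} → Decidable P → Dec (∀ a → P a)) →
            {P : Maybe A → Set} → Decidable P → Dec (∀ m → P m)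
allMaybe? all P? = map′ (λ { (n , j) → λ { nothing → n ; (just a) → j a } })
  (λ h → h nothing , h ∘ just) (P? nothing ×-dec all (P? ∘ just))

allMasks? : ∀ {P : Masks → Set} → Decidable P → Dec (∀ m → P m)
allMasks? = allVec? (allVec? allBool? 3) 3

Preserved : Stage → Masks → Set
Preserved s m = T (good s m) → ∀ mv b → T (good (stageStep mv s) (masksStep mv b s m))

-- An input earns 2 · 23/16 reads, counted for each of the two outcomes of the
-- coin of process 0: this is 46 sixteenths per unit of the offline cost.
Paid : Stage → Masks → Set
Paid s m = T (good s m) → ∀ mv → after mv true ℕ.+ after mv false ℕ.≤ debt s m ℕ.+ debt s m ℕ.+ 46 ℕ.* credit mv
  where
  after : Maybe Proc → Bool → ℕ
  after mv b = 16 ℕ.* readsStep mv b s m ℕ.+ debt (stageStep mv s) (masksStep mv b s m)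

canRead : Stage → Masks → ∀ {i} → Target i → Bool
canRead s m (j , _) = readable j (lookup m j) ∧ fresh s j

-- This licenses each planned read for `absorb-partial`: the register shows its owner's current
-- knowledge, and the holes in it are harmless.
Reading : Stage → Masks → Set
Reading s m = T (good s m) → ∀ b i → T (maybe (canRead s m) true (plan s b i))

abstract
  preserved : ∀ s m → Preserved s m
  preserved = toWitness {a? = all? λ s → allMasks? λ m → T? _ →-dec
    allMaybe? all? λ mv → allBool? λ b → T? _} tt

  paid : ∀ s m → Paid s m
  paid = toWitness {a? = all? λ s → allMasks? λ m → T? _ →-dec
    allMaybe? all? λ mv → _ ℕ.≤? _} tt

  reading : ∀ s m → Reading s m
  reading = toWitness {a? = all? λ s → allMasks? λ m → T? _ →-dec
    allBool? λ b → all? λ i → T? _} tt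

-- A read changes what a process knows but not its register, so freshness is promised only after a
-- round in which no read is planned.
fresh-write : ∀ s b i → T (fresh (later s) i) → plan s b i ≡ nothing
fresh-write 0F b 0F _ = refl
fresh-write 4F b 0F _ = refl
fresh-write 5F b 0F _ = refl
fresh-write 6F b 0F _ = refl
fresh-write 7F b 0F _ = refl
fresh-write 0F b (suc i) _ = refl
fresh-write 1F b (suc i) _ = refl
fresh-write 2F b (suc i) _ = refl
fresh-write 3F b (suc i) _ = refl
fresh-write 4F b (suc i) _ = refl
fresh-write 6F b (suc i) _ = refl
fresh-write 7F b (suc i) _ = refl

-- Simulation of the hub algorithm by the abstract configurations.

module HubSimulation where
  open Algorithm hub
  open Execution hub

  -- A pending notification is already counted here; with the stored states alone the processes
  -- would not share a stage.
  view : Config → Proc → State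
  view C i = tick (notified C i) (state C i)

  record Sim (C : Config) (I : List Input) (s : Stage) (m : Masks) : Set where
    field
      stageOK : ∀ i → proj₁ (view C i) ≡ s
      partial : ∀ i → Partial (lookup m i) (proj₂ (view C i)) I
      freshOK : ∀ i → T (fresh s i) → register C i ≡ publish (proj₂ (view C i))
  open Sim

  record Acted (I : List Input) (s : Stage) (i : Proc) (g : Maybe Proc) (M : Mask) (e : Effect) : Set where
    field
      stage′   : proj₁ (newState e) ≡ later s
      partial′ : Partial (afterRead g M) (proj₂ (newState e)) I
      fresh′   : T (fresh (later s) i) → newRegister e ≡ publish (proj₂ (newState e))
      reads′   : readCount e ℕ.≤ readsOf g M
  open Acted

  T-∧ˡ : ∀ {a b} → T (a ∧ b) → T a
  T-∧ˡ {true} _ = tt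

  T-∧ʳ : ∀ {a b} → T (a ∧ b) → T b
  T-∧ʳ {true} p = p

  module _ {C I s m} (ok : T (good s m)) (sim : Sim C I s m) where

    act-acted : ∀ i V b → proj₁ V ≡ s → Partial (lookup m i) (proj₂ V) I →
                Acted I s i (target s b i) (lookup m i) (perform C i (act i V b))
    act-acted i (_ , K) b refl p with plan s b i | complete K in full | reading s m ok b i | fresh-write s b i
    ... | nothing | _ | _ | _ = record
      { stage′ = refl ; partial′ = p ; fresh′ = λ _ → refl ; reads′ = z≤n }
    ... | just (j , j≢i) | true | _ | _ = record
      { stage′ = refl ; partial′ = full-partial full p ; fresh′ = λ _ → refl ; reads′ = z≤n }
    ... | just (j , j≢i) | false | r | w = record
      { stage′   = refl
      ; partial′ = subst (λ R → Partial (afterRead (just j) (lookup m i)) (absorb j K R) I)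
                     (sym (freshOK sim j (T-∧ʳ {readable j (lookup m j)} r)))
                     (absorb-partial j (T-∧ˡ r) p (partial sim j))
      ; fresh′   = λ f → case w f of λ ()
      ; reads′   = one
      }
      where
      -- An actual read means that `K` is incomplete, so the mask cannot be empty and the
      -- abstraction counts a read as well.
      one : 1 ℕ.≤ readsOf (just j) (lookup m i)
      one with isEmpty (lookup m i) in e
      ... | true  = true-false-absurd (complete-full {lookup m i} (subst T (sym e) tt) p) full
      ... | false = s≤s z≤n

    -- Only the plan of process 0 looks at a coin, so one coin per round drives the abstraction.
    coin-of : ∀ (c : Coins 1) i → target s (head (lookup c i)) i ≡ target s (head (head c)) i
    coin-of (_ ∷ _) 0F = refl
    coin-of c (suc i) = refl

    acted : ∀ c i → Acted I s i (target s (head (head c)) i) (lookup m i) (ordinaryStep C c i)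
    acted c i = subst (λ g → Acted I s i g (lookup m i) (ordinaryStep C c i)) (coin-of c i)
      (act-acted i (view C i) (head (lookup c i)) (stageOK sim i) (partial sim i))

    reads-step : ∀ mv c i → readCount (localStep C (mv , c) i) ℕ.≤
      readStep (Maybe.map proj₁ mv) (target s (head (head c)) i) i (lookup m i)
    reads-step nothing        c i = reads′ (acted c i)
    reads-step (just (j , v)) c i with j ≟ i
    ... | yes _ = z≤n
    ... | no  _ = reads′ (acted c i)

    extend : Maybe Input → List Input
    extend nothing  = I
    extend (just x) = I ∷ʳ x

    Stepped : Maybe Input → Coins 1 → Set
    Stepped mv c = Sim (next C (mv , c)) (extend mv)
      (stageStep (Maybe.map proj₁ mv) s) (masksStep (Maybe.map proj₁ mv) (head (head c)) s m)

    append-known : ∀ {M K} x → Partial M K I → Partial M (K ∷ʳ just x) (I ∷ʳ x)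
    append-known x p = Pointwise.++⁺ p (known ∷ [])

    append-hole : ∀ {M K} x → Partial M K I → Partial (M [ proj₁ x ]≔ true) (K ∷ʳ nothing) (I ∷ʳ x)
    append-hole {M} x@(j , _) p = Pointwise.++⁺ (weaken grow p) (hole (lookup∘updateAt j M) ∷ [])
      where
      grow : ∀ t → lookup M t ≡ true → lookup (M [ j ]≔ true) t ≡ true
      grow t h with t ≟ j
      ... | yes refl = lookup∘updateAt j M
      ... | no  t≢j  = trans (lookup∘updateAt′ t j t≢j M) h

    sim-step : ∀ mv c → Stepped mv c
    sim-step nothing c = record
      { stageOK = λ i → stage′ (acted c i)
      ; partial = λ i → subst (λ M → Partial M (proj₂ (newState (ordinaryStep C c i))) I)
          (sym (lookup∘tabulate (λ i → maskStep nothing (target s (head (head c)) i) i (lookup m i)) i))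
          (partial′ (acted c i))
      ; freshOK = λ i → fresh′ (acted c i)
      }
    sim-step (just x@(j , v)) c = record
      { stageOK = stage₀
      ; partial = λ i → subst (λ M → Partial M (proj₂ (view (next C (just x , c)) i)) (I ∷ʳ x))
          (sym (lookup∘tabulate (λ i → maskStep (just j) (target s (head (head c)) i) i (lookup m i)) i))
          (partial₀ i)
      ; freshOK = λ i ()
      }
      where
      stage₀ : ∀ i → proj₁ (view (next C (just x , c)) i) ≡ 0F
      stage₀ i with j ≟ i
      ... | yes _ = refl
      ... | no  _ = refl
      partial₀ : ∀ i → Partial (maskStep (just j) (target s (head (head c)) i) i (lookup m i))
                         (proj₂ (view (next C (just x , c)) i)) (I ∷ʳ x)
      partial₀ i with j ≟ i
      ... | yes refl = append-known x (partial sim i)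
      ... | no  _    = append-hole x (partial′ (acted c i))

  stageOf : History 1 → Stage
  stageOf []             = 7F
  stageOf ((mv , _) ∷ h) = stageStep (Maybe.map proj₁ mv) (stageOf h)

  masksOf : History 1 → Masks
  masksOf []             = replicate 3 (replicate 3 false)
  masksOf ((mv , c) ∷ h) = masksStep (Maybe.map proj₁ mv) (head (head c)) (stageOf h) (masksOf h)

  readsBound : History 1 → ℕ
  readsBound []             = 0
  readsBound ((mv , c) ∷ h) =
    readsBound h ℕ.+ readsStep (Maybe.map proj₁ mv) (head (head c)) (stageOf h) (masksOf h)

  good-run : ∀ h → T (good (stageOf h) (masksOf h))
  good-run []             = tt
  good-run ((mv , c) ∷ h) = preserved (stageOf h) (masksOf h) (good-run h) (Maybe.map proj₁ mv) (head (head c))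

  sim-run : ∀ h → Sim (run h) (inputs h) (stageOf h) (masksOf h)
  sim-run [] = record { stageOK = λ _ → refl ; partial = λ _ → [] ; freshOK = λ _ _ → refl }
  sim-run ((nothing , c) ∷ h) = sim-step (good-run h) (sim-run h) nothing c
  sim-run ((just x  , c) ∷ h) = sim-step (good-run h) (sim-run h) (just x) c

  cost-bound : ∀ h → cost h ℕ.≤ readsBound h
  cost-bound []             = z≤n
  cost-bound ((mv , c) ∷ h) = ℕ.+-mono-≤ (cost-bound h)
    (ℕ.+-mono-≤ (r 0F) (ℕ.+-mono-≤ (r 1F) (ℕ.+-mono-≤ (r 2F) z≤n)))
    where r = reads-step (good-run h) (sim-run h) mv c

  -- In stage 7 the invariant makes all masks empty and every register is fresh, so what is
  -- published is the sequence itself.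
  done : ∀ h → stageOf h ≡ 7F → Done h
  done h at7 i with stageOf h | masksOf h | good-run h | sim-run h
  done h refl i | 7F | m | ok | sim = trans (freshOK sim i tt) (publish-full (empty m ok i) (partial sim i))
    where
    empty : ∀ m → T (good 7F m) → ∀ i → T (isEmpty (lookup m i))
    empty (M₀ ∷ M₁ ∷ M₂ ∷ []) ok with T-∧ʳ {not (lookup M₂ 2F)} (T-∧ʳ {not (lookup M₁ 1F)} (T-∧ʳ {not (lookup M₀ 0F)} ok))
    ... | e = λ { 0F → T-∧ˡ e ; 1F → T-∧ˡ (T-∧ʳ {isEmpty M₀} e) ; 2F → T-∧ʳ {isEmpty M₁} (T-∧ʳ {isEmpty M₀} e) }

  settles : ∀ s → later (later (later (later (later (later (later s)))))) ≡ 7F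
  settles 0F = refl
  settles 1F = refl
  settles 2F = refl
  settles 3F = refl
  settles 4F = refl
  settles 5F = refl
  settles 6F = refl
  settles 7F = refl

  settled : ∀ ω h d → stageOf (idle ω (d ℕ.+ 7) h) ≡ 7F
  settled ω h zero    = settles (stageOf h)
  settled ω h (suc d) = cong later (settled ω h d)

  hub-solves : ∀ τ → Solves τ hub
  -- Seven idle rounds lead from any stage to stage 7, which then persists.
  hub-solves τ h _ ω = 7 , λ t 7≤t → subst (λ t → Done (idle ω t h)) (ℕ.m∸n+n≡m 7≤t)
    (done (idle ω (t ℕ.∸ 7 ℕ.+ 7) h) (settled ω h (t ℕ.∸ 7)))

open HubSimulation

-- The embedding of the natural numbers into the rationals.

fromℕ-unnormalised : ∀ n → toℚᵘ (fromℕ n) ℚᵘ.≃ ℚᵘ.mkℚᵘ (+ n) 0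
fromℕ-unnormalised n = toℚᵘ-fromℚᵘ (ℚᵘ.mkℚᵘ (+ n) 0)

fromℕ-+ : ∀ m n → fromℕ (m ℕ.+ n) ≡ fromℕ m + fromℕ n
fromℕ-+ m n = toℚᵘ-injective (begin-equality
  toℚᵘ (fromℕ (m ℕ.+ n))                  ≃⟨ fromℕ-unnormalised (m ℕ.+ n) ⟩
  ℚᵘ.mkℚᵘ (+ (m ℕ.+ n)) 0                 ≃⟨ ℚᵘ.*≡* (solve 2 (λ a b → (a :+ b) :* con (+ 1)
       := (a :* con (+ 1) :+ b :* con (+ 1)) :* con (+ 1)) refl (+ m) (+ n)) ⟩
  ℚᵘ.mkℚᵘ (+ m) 0 ℚᵘ.+ ℚᵘ.mkℚᵘ (+ n) 0    ≃⟨ ℚᵘ.+-cong (fromℕ-unnormalised m) (fromℕ-unnormalised n) ⟨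
  toℚᵘ (fromℕ m) ℚᵘ.+ toℚᵘ (fromℕ n)      ≃⟨ toℚᵘ-homo-+ (fromℕ m) (fromℕ n) ⟨
  toℚᵘ (fromℕ m + fromℕ n)                ∎)
  where
  open ℚᵘ.≤-Reasoning
  open ℤ.+-*-Solver

fromℕ-* : ∀ m n → fromℕ (m ℕ.* n) ≡ fromℕ m * fromℕ n
fromℕ-* zero    n = sym (*-zeroˡ (fromℕ n))
fromℕ-* (suc m) n = begin
  fromℕ (n ℕ.+ m ℕ.* n)            ≡⟨ fromℕ-+ n (m ℕ.* n) ⟩
  fromℕ n + fromℕ (m ℕ.* n)        ≡⟨ cong₂ _+_ (sym (*-identityˡ (fromℕ n))) (fromℕ-* m n) ⟩
  1ℚ * fromℕ n + fromℕ m * fromℕ n ≡⟨ *-distribʳ-+ (fromℕ n) 1ℚ (fromℕ m) ⟨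
  (1ℚ + fromℕ m) * fromℕ n         ≡⟨ cong (_* fromℕ n) (fromℕ-+ 1 m) ⟨
  fromℕ (suc m) * fromℕ n          ∎
  where open ≡-Reasoning

fromℕ-mono : ∀ {m n} → m ℕ.≤ n → fromℕ m ≤ fromℕ n
fromℕ-mono {m} {n} m≤n = toℚᵘ-cancel-≤ (begin
  toℚᵘ (fromℕ m)  ≃⟨ fromℕ-unnormalised m ⟩
  ℚᵘ.mkℚᵘ (+ m) 0 ≤⟨ ℚᵘ.*≤* (ℤ.*-monoʳ-≤-nonNeg (+ 1) (ℤ.+≤+ m≤n)) ⟩
  ℚᵘ.mkℚᵘ (+ n) 0 ≃⟨ fromℕ-unnormalised n ⟨
  toℚᵘ (fromℕ n)  ∎)
  where open ℚᵘ.≤-Reasoning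

-- Averages over coin tosses.

averageBits-cong : ∀ n {f g : Vec Bool n → ℚ} → (∀ v → f v ≡ g v) → averageBits n f ≡ averageBits n g
averageBits-cong zero    f≡g = f≡g []
averageBits-cong (suc n) f≡g = cong₂ (λ x y → ½ * (x + y))
  (averageBits-cong n λ v → f≡g (true ∷ v)) (averageBits-cong n λ v → f≡g (false ∷ v))

averageBits-mono : ∀ n {f g : Vec Bool n → ℚ} → (∀ v → f v ≤ g v) → averageBits n f ≤ averageBits n g
averageBits-mono zero    f≤g = f≤g []
averageBits-mono (suc n) f≤g = *-monoˡ-≤-nonNeg ½
  (+-mono-≤ (averageBits-mono n λ v → f≤g (true ∷ v)) (averageBits-mono n λ v → f≤g (false ∷ v)))

averageBits-affine : ∀ n a (f g : Vec Bool n → ℚ) →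
  averageBits n (λ v → a * f v + g v) ≡ a * averageBits n f + averageBits n g
averageBits-affine zero    a f g = refl
averageBits-affine (suc n) a f g = trans
  (cong₂ (λ x y → ½ * (x + y)) (averageBits-affine n a _ _) (averageBits-affine n a _ _))
  (solve 6 (λ h a x y z w → h :* ((a :* x :+ y) :+ (a :* z :+ w)) := a :* (h :* (x :+ z)) :+ h :* (y :+ w)) refl ½ a
    (averageBits n λ v → f (true ∷ v)) (averageBits n λ v → g (true ∷ v))
    (averageBits n λ v → f (false ∷ v)) (averageBits n λ v → g (false ∷ v)))
  where open +-*-Solver

averageBits-const : ∀ n q → averageBits n (λ _ → q) ≡ q
averageBits-const zero    q = refl
averageBits-const (suc n) q = trans (cong (λ x → ½ * (x + x)) (averageBits-const n q))
  (solve 1 (λ x → con ½ :* (x :+ x) := x) refl q)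
  where open +-*-Solver

averageCoins-cong : ∀ k n {f g : Vec (Vec Bool k) n → ℚ} → (∀ v → f v ≡ g v) → averageCoins k n f ≡ averageCoins k n g
averageCoins-cong k zero    f≡g = f≡g []
averageCoins-cong k (suc n) f≡g = averageBits-cong k λ b → averageCoins-cong k n λ v → f≡g (b ∷ v)

averageCoins-mono : ∀ k n {f g : Vec (Vec Bool k) n → ℚ} → (∀ v → f v ≤ g v) → averageCoins k n f ≤ averageCoins k n g
averageCoins-mono k zero    f≤g = f≤g []
averageCoins-mono k (suc n) f≤g = averageBits-mono k λ b → averageCoins-mono k n λ v → f≤g (b ∷ v)

averageCoins-affine : ∀ k n a (f g : Vec (Vec Bool k) n → ℚ) →
  averageCoins k n (λ v → a * f v + g v) ≡ a * averageCoins k n f + averageCoins k n g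
averageCoins-affine k zero    a f g = refl
averageCoins-affine k (suc n) a f g = trans
  (averageBits-cong k λ b → averageCoins-affine k n a (λ v → f (b ∷ v)) (λ v → g (b ∷ v)))
  (averageBits-affine k a _ _)

averageCoins-const : ∀ k n q → averageCoins k n (λ _ → q) ≡ q
averageCoins-const k zero    q = refl
averageCoins-const k (suc n) q =
  trans (averageBits-cong k λ _ → averageCoins-const k n q) (averageBits-const k q)

averageCoins-head : ∀ k n (f : Vec Bool k → ℚ) → averageCoins k (suc n) (λ c → f (head c)) ≡ averageBits k f
averageCoins-head k n f = averageBits-cong k λ b → averageCoins-const k n (f b)

-- The drift condition makes `Ψ` a supermartingale under the adversary's strategy, so its
-- expectation after T rounds is at most its present value.
potential-method : ∀ {k} a (σ : History k → Maybe Input) (X Y Ψ : History k → ℚ) →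
  (∀ h → X h ≤ a * Y h + Ψ h) →
  (∀ h → averageCoins k 3 (λ c → Ψ ((σ h , c) ∷ h)) ≤ Ψ h) →
  ∀ T h → expectation σ X T h ≤ a * expectation σ Y T h + Ψ h
potential-method a σ X Y Ψ bound drift zero    h = bound h
potential-method {k} a σ X Y Ψ bound drift (suc T) h = begin
  averageCoins k 3 (λ c → expectation σ X T (h′ c))
    ≤⟨ averageCoins-mono k 3 (λ c → potential-method a σ X Y Ψ bound drift T (h′ c)) ⟩
  averageCoins k 3 (λ c → a * expectation σ Y T (h′ c) + Ψ (h′ c))
    ≡⟨ averageCoins-affine k 3 a (λ c → expectation σ Y T (h′ c)) (λ c → Ψ (h′ c)) ⟩
  a * averageCoins k 3 (λ c → expectation σ Y T (h′ c)) + averageCoins k 3 (λ c → Ψ (h′ c))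
    ≤⟨ +-monoʳ-≤ (a * averageCoins k 3 (λ c → expectation σ Y T (h′ c))) (drift h) ⟩
  a * averageCoins k 3 (λ c → expectation σ Y T (h′ c)) + Ψ h ∎
  where
  open ≤-Reasoning
  h′ = λ c → (σ h , c) ∷ h

opt-∷ʳ : ∀ I x → opt (I ∷ʳ x) ≡ opt I ℕ.+ 2
opt-∷ʳ []            (0F , _) = refl
opt-∷ʳ []            (1F , _) = refl
opt-∷ʳ []            (2F , _) = refl
opt-∷ʳ ((0F , _) ∷ I) x = cong (2 ℕ.+_) (opt-∷ʳ I x)
opt-∷ʳ ((1F , _) ∷ I) x = cong (2 ℕ.+_) (opt-∷ʳ I x)
opt-∷ʳ ((2F , _) ∷ I) x = cong (2 ℕ.+_) (opt-∷ʳ I x)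

opt-step : ∀ (mv : Maybe Input) (c : Coins 1) h →
  opt (inputs ((mv , c) ∷ h)) ≡ opt (inputs h) ℕ.+ credit (Maybe.map proj₁ mv)
opt-step nothing  c h = sym (ℕ.+-identityʳ _)
opt-step (just x) c h = opt-∷ʳ (inputs h) x

sixteenth ratio : ℚ
sixteenth = + 1 / 16
ratio     = + 23 / 16

charge : History 1 → ℕ
charge h = 16 ℕ.* readsBound h ℕ.+ debt (stageOf h) (masksOf h)

charge-step : Maybe Proc → Bool → History 1 → ℕ
charge-step mv b h = 16 ℕ.* (readsBound h ℕ.+ readsStep mv b (stageOf h) (masksOf h)) ℕ.+
  debt (stageStep mv (stageOf h)) (masksStep mv b (stageOf h) (masksOf h))

charge-paid : ∀ mv h → charge-step mv true h ℕ.+ charge-step mv false h ℕ.≤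
  charge h ℕ.+ charge h ℕ.+ 46 ℕ.* credit mv
charge-paid mv h = begin
  16 ℕ.* (R ℕ.+ r true) ℕ.+ d true ℕ.+ (16 ℕ.* (R ℕ.+ r false) ℕ.+ d false)
    ≡⟨ solve 5 (λ R a b x y → con 16 :* (R :+ a) :+ x :+ (con 16 :* (R :+ b) :+ y)
         := con 16 :* R :+ con 16 :* R :+ (con 16 :* a :+ x :+ (con 16 :* b :+ y)))
         refl R (r true) (r false) (d true) (d false) ⟩
  16 ℕ.* R ℕ.+ 16 ℕ.* R ℕ.+ (16 ℕ.* r true ℕ.+ d true ℕ.+ (16 ℕ.* r false ℕ.+ d false))
    ≤⟨ ℕ.+-monoʳ-≤ (16 ℕ.* R ℕ.+ 16 ℕ.* R) (paid (stageOf h) (masksOf h) (good-run h) mv) ⟩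
  16 ℕ.* R ℕ.+ 16 ℕ.* R ℕ.+ (D ℕ.+ D ℕ.+ 46 ℕ.* credit mv)
    ≡⟨ solve 3 (λ R D C → con 16 :* R :+ con 16 :* R :+ (D :+ D :+ C)
         := con 16 :* R :+ D :+ (con 16 :* R :+ D) :+ C) refl R D (46 ℕ.* credit mv) ⟩
  charge h ℕ.+ charge h ℕ.+ 46 ℕ.* credit mv ∎
  where
  open ℕ.≤-Reasoning
  open ℕ.+-*-Solver
  R = readsBound h
  D = debt (stageOf h) (masksOf h)
  r d : Bool → ℕ
  r b = readsStep mv b (stageOf h) (masksOf h)
  d b = debt (stageStep mv (stageOf h)) (masksStep mv b (stageOf h) (masksOf h))

abstract
  -- Here `a` counts sixteenths of a read and `o` is the offline cost: the balance is the excess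
  -- over the allowance of 23/16 per unit of `o`.
  balance : ℕ → ℕ → ℚ
  balance a o = sixteenth * fromℕ a - ratio * fromℕ o

  balance-drift : ∀ a b n o d → a ℕ.+ b ℕ.≤ n ℕ.+ n ℕ.+ 46 ℕ.* d →
    ½ * (balance a (o ℕ.+ d) + balance b (o ℕ.+ d)) ≤ balance n o
  balance-drift a b n o d a+b≤ = begin
    ½ * ((sixteenth * fromℕ a - ratio * fromℕ (o ℕ.+ d)) + (sixteenth * fromℕ b - ratio * fromℕ (o ℕ.+ d)))
      ≡⟨ cong (λ x → ½ * ((sixteenth * fromℕ a - ratio * x) + (sixteenth * fromℕ b - ratio * x))) (fromℕ-+ o d) ⟩
    ½ * ((sixteenth * fromℕ a - ratio * (O + D)) + (sixteenth * fromℕ b - ratio * (O + D)))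
      ≡⟨ solve 4 (λ a b o d → con ½ :* ((con sixteenth :* a :- con ratio :* (o :+ d)) :+ (con sixteenth :* b :- con ratio :* (o :+ d)))
           := con (+ 1 / 32) :* (a :+ b) :- con ratio :* (o :+ d)) refl (fromℕ a) (fromℕ b) O D ⟩
    (+ 1 / 32) * (fromℕ a + fromℕ b) - ratio * (O + D)
      ≡⟨ cong (λ x → (+ 1 / 32) * x - ratio * (O + D)) (fromℕ-+ a b) ⟨
    (+ 1 / 32) * fromℕ (a ℕ.+ b) - ratio * (O + D)
      ≤⟨ +-monoˡ-≤ (- (ratio * (O + D))) (*-monoˡ-≤-nonNeg (+ 1 / 32) (fromℕ-mono a+b≤)) ⟩
    (+ 1 / 32) * fromℕ (n ℕ.+ n ℕ.+ 46 ℕ.* d) - ratio * (O + D)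
      ≡⟨ cong (λ x → (+ 1 / 32) * x - ratio * (O + D))
           (trans (fromℕ-+ (n ℕ.+ n) (46 ℕ.* d)) (cong₂ _+_ (fromℕ-+ n n) (fromℕ-* 46 d))) ⟩
    (+ 1 / 32) * (N + N + fromℕ 46 * D) - ratio * (O + D)
      -- As 46/32 = 23/16, the earnings of an input cancel the growth of the allowance exactly.
      ≡⟨ solve 3 (λ n o d → con (+ 1 / 32) :* (n :+ n :+ con (fromℕ 46) :* d) :- con ratio :* (o :+ d)
           := con sixteenth :* n :- con ratio :* o) refl N O D ⟩
    sixteenth * N - ratio * O ∎
    where
    open ≤-Reasoning
    open +-*-Solver
    N O D : ℚ
    N = fromℕ n
    O = fromℕ o
    D = fromℕ d

  balance-bound : ∀ r d o → fromℕ r ≤ ratio * fromℕ o + balance (16 ℕ.* r ℕ.+ d) o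
  balance-bound r d o = begin
    fromℕ r
      ≡⟨ solve 1 (λ r → r := con sixteenth :* (con (fromℕ 16) :* r)) refl (fromℕ r) ⟩
    sixteenth * (fromℕ 16 * fromℕ r)
      ≡⟨ cong (sixteenth *_) (fromℕ-* 16 r) ⟨
    sixteenth * fromℕ (16 ℕ.* r)
      ≤⟨ *-monoˡ-≤-nonNeg sixteenth (fromℕ-mono (ℕ.m≤m+n (16 ℕ.* r) d)) ⟩
    sixteenth * fromℕ (16 ℕ.* r ℕ.+ d)
      ≡⟨ solve 2 (λ x y → x := y :+ (x :- y)) refl (sixteenth * fromℕ (16 ℕ.* r ℕ.+ d)) (ratio * fromℕ o) ⟩
    ratio * fromℕ o + balance (16 ℕ.* r ℕ.+ d) o ∎
    where
    open ≤-Reasoning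
    open +-*-Solver

-- The coins of processes 1 and 2 average out, which leaves the mean over the two outcomes for
-- process 0.
averageCoins-first : ∀ (Ψ : Coins 1 → ℚ) (f : Bool → ℚ) q → (∀ c → Ψ c ≡ f (head (head c))) →
  ½ * (f true + f false) ≤ q → averageCoins 1 3 Ψ ≤ q
averageCoins-first Ψ f q Ψ≡f f≤q = subst (_≤ q)
  (sym (trans (averageCoins-cong 1 3 {Ψ} {λ c → f (head (head c))} Ψ≡f) (averageCoins-head 1 2 (λ v → f (head v))))) f≤q

potential : History 1 → ℚ
potential h = balance (charge h) (opt (inputs h))

potential-drift : ∀ (σ : History 1 → Maybe Input) h → averageCoins 1 3 (λ c → potential ((σ h , c) ∷ h)) ≤ potential h
potential-drift σ h = averageCoins-first (λ c → potential ((σ h , c) ∷ h)) after (potential h)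
  (λ c → cong (balance (charge-step mv (head (head c)) h)) (opt-step (σ h) c h))
  (balance-drift (charge-step mv true h) (charge-step mv false h) (charge h) (opt (inputs h)) (credit mv) (charge-paid mv h))
  where
  mv = Maybe.map proj₁ (σ h)
  after : Bool → ℚ
  after b = balance (charge-step mv b h) (opt (inputs h) ℕ.+ credit mv)

cost-potential : ∀ h → fromℕ (Execution.cost hub h) ≤ ratio * fromℕ (opt (inputs h)) + potential h
cost-potential h = ≤-trans (fromℕ-mono (cost-bound h))
  (balance-bound (readsBound h) (debt (stageOf h) (masksOf h)) (opt (inputs h)))

hub-competitive : ∀ τ → CompetitiveInExpectation τ hub (+ 23 / 16)
hub-competitive τ = potential [] , λ adv T →
  potential-method ratio (Adversary.move adv) (λ h → fromℕ (Execution.cost hub h)) (λ h → fromℕ (opt (inputs h))) potential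
    cost-potential (potential-drift (Adversary.move adv)) T []

-- The lower bound for deterministic algorithms.

other : Proc → Proc
other 0F = 1F
other _  = 0F

other≢ : ∀ k → k ≢ other k
other≢ 0F ()
other≢ 1F ()
other≢ 2F ()

third : Proc → Proc → Proc
third 0F 1F = 2F
third 0F 2F = 1F
third 1F 0F = 2F
third 2F 0F = 1F
-- This is the right value for processes 1 and 2; for equal arguments it is arbitrary.
third _  _  = 0F

third≢ : ∀ k j → k ≢ j → k ≢ third k j × j ≢ third k j
third≢ = toWitness {a? = all? λ k → all? λ j → ¬? (k ≟ j) →-dec (¬? (k ≟ third k j) ×-dec ¬? (j ≟ third k j))} tt

sum-split : ∀ (f : Proc → ℕ) k j → k ≢ j → f 0F ℕ.+ (f 1F ℕ.+ f 2F) ≡ f k ℕ.+ (f j ℕ.+ f (third k j))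
sum-split f 0F 1F _ = refl
sum-split f 0F 2F _ = cong (f 0F ℕ.+_) (ℕ.+-comm (f 1F) (f 2F))
sum-split f 1F 0F _ = solve 3 (λ a b c → a :+ (b :+ c) := b :+ (a :+ c)) refl (f 0F) (f 1F) (f 2F)
  where open ℕ.+-*-Solver
sum-split f 1F 2F _ = solve 3 (λ a b c → a :+ (b :+ c) := b :+ (c :+ a)) refl (f 0F) (f 1F) (f 2F)
  where open ℕ.+-*-Solver
sum-split f 2F 0F _ = solve 3 (λ a b c → a :+ (b :+ c) := c :+ (a :+ b)) refl (f 0F) (f 1F) (f 2F)
  where open ℕ.+-*-Solver
sum-split f 2F 1F _ = solve 3 (λ a b c → a :+ (b :+ c) := c :+ (b :+ a)) refl (f 0F) (f 1F) (f 2F)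
  where open ℕ.+-*-Solver
sum-split f 0F 0F k≢j = contradiction refl k≢j
sum-split f 1F 1F k≢j = contradiction refl k≢j
sum-split f 2F 2F k≢j = contradiction refl k≢j

aimOf : ∀ {S i} → Action S i → Maybe Proc
aimOf (skip _)     = nothing
aimOf (write _ _)  = nothing
aimOf (read j _ _) = just j

aimOf-≢ : ∀ {S i j} (a : Action S i) → aimOf a ≡ just j → i ≢ j
aimOf-≢ (read j j≢i _) refl i≡j = j≢i (sym i≡j)

just? : ∀ {A : Set} (m : Maybe A) → (∃ λ a → m ≡ just a) ⊎ m ≡ nothing
just? (just a) = inj₁ (a , refl)
just? nothing  = inj₂ refl

module LowerBound (A : DeterministicAlgorithm) where
  open Algorithm A
  open Execution A

  tosses : Coins 0
  tosses = replicate 3 []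

  wait-for : ℕ → History 0 → History 0
  wait-for = idle (λ _ → tosses)

  given : History 0 → Proc → ℕ → History 0
  given h i v = (just (i , v) , tosses) ∷ h

  action : Config → (k : Proc) → Action State k
  action C k = step k (state C k) (notified C k) (lookup tosses k)

  aim : Config → Proc → Maybe Proc
  aim C k = aimOf (action C k)

  tally : Proc → History 0 → ℕ
  tally k []      = 0
  tally k (r ∷ h) = tally k h ℕ.+ readCount (localStep (run h) r k)

  cost-tally : ∀ h → cost h ≡ tally 0F h ℕ.+ (tally 1F h ℕ.+ tally 2F h)
  cost-tally []      = refl
  cost-tally (r ∷ h) = trans (cong (ℕ._+ (x ℕ.+ (y ℕ.+ (z ℕ.+ 0)))) (cost-tally h))
    (solve 6 (λ a b c x y z → a :+ (b :+ c) :+ (x :+ (y :+ (z :+ con 0))) := a :+ x :+ (b :+ y :+ (c :+ z)))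
      refl (tally 0F h) (tally 1F h) (tally 2F h) x y z)
    where
    open ℕ.+-*-Solver
    x = readCount (localStep (run h) r 0F)
    y = readCount (localStep (run h) r 1F)
    z = readCount (localStep (run h) r 2F)

  tally-mono : ∀ k n h → tally k h ℕ.≤ tally k (wait-for n h)
  tally-mono k zero    h = ℕ.≤-refl
  tally-mono k (suc n) h = ℕ.≤-trans (tally-mono k n h) (ℕ.m≤m+n _ _)

  -- State and notice determine the next action of `k`; the register is included because it is what
  -- other processes see of `k`.
  record Agree (k : Proc) (C C′ : Config) : Set where
    constructor agree
    field
      sameState    : state C k ≡ state C′ k
      sameRegister : register C k ≡ register C′ k
      sameNotice   : notified C k ≡ notified C′ k
  open Agree

  Agree-sym : ∀ {k C C′} → Agree k C C′ → Agree k C′ C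
  Agree-sym (agree s r n) = agree (sym s) (sym r) (sym n)

  Agree-trans : ∀ {k C C′ C″} → Agree k C C′ → Agree k C′ C″ → Agree k C C″
  Agree-trans (agree s r n) (agree s′ r′ n′) = agree (trans s s′) (trans r r′) (trans n n′)

  agree-action : ∀ {k C C′} → Agree k C C′ → action C k ≡ action C′ k
  agree-action {k} (agree s _ n) = cong₂ (λ s n → step k s n (lookup tosses k)) s n

  agree-aim : ∀ {k C C′} → Agree k C C′ → aim C k ≡ aim C′ k
  agree-aim ag = cong aimOf (agree-action ag)

  perform-agree : ∀ {k C C′} (a : Action State k) → register C k ≡ register C′ k →
    (∀ j → aimOf a ≡ just j → register C j ≡ register C′ j) → perform C k a ≡ perform C′ k a
  perform-agree (skip s)        r _ = cong (λ R → effect s R 0) r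
  perform-agree (write R s)     _ _ = refl
  perform-agree (read j _ cont) r seen = cong₂ (λ R R′ → effect (cont R) R′ 1) (seen j refl) r

  agree-next : ∀ {k C C′} → Agree k C C′ → (∀ j → aim C k ≡ just j → register C j ≡ register C′ j) →
    Agree k (next C (nothing , tosses)) (next C′ (nothing , tosses))
  agree-next {k} {C} {C′} ag seen = agree (cong newState e) (cong newRegister e) refl
    where
    e : perform C k (action C k) ≡ perform C′ k (action C′ k)
    e = trans (perform-agree (action C k) (sameRegister ag) seen) (cong (perform C′ k) (agree-action ag))

  agree-quiet : ∀ {k C C′} → Agree k C C′ → aim C k ≡ nothing →
    Agree k (next C (nothing , tosses)) (next C′ (nothing , tosses))
  agree-quiet ag quiet = agree-next ag λ j seen → contradiction (trans (sym quiet) seen) λ ()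

  ordinary : ∀ C {k i v} → k ≢ i → localStep C (just (i , v) , tosses) k ≡ ordinaryStep C tosses k
  ordinary C {k} {i} k≢i with i ≟ k
  ... | yes i≡k = contradiction (sym i≡k) k≢i
  ... | no  _   = refl

  notice : ∀ h {k i v} → k ≢ i → notified (run (given h i v)) k ≡ true
  notice h {k} {i} k≢i with i ≟ k
  ... | yes i≡k = contradiction (sym i≡k) k≢i
  ... | no  _   = refl

  -- The notification reveals neither receiver nor number, and in the round of the input `k` acts on
  -- the common history `h`.
  agree-given : ∀ h {k i i′ v v′} → k ≢ i → k ≢ i′ → Agree k (run (given h i v)) (run (given h i′ v′))
  agree-given h {k} {i} {i′} {v} {v′} k≢i k≢i′ = agree (cong newState e)
       (cong newRegister e) (trans (notice h {v = v} k≢i) (sym (notice h {v = v′} k≢i′)))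
    where
    e : localStep (run h) (just (i , v) , tosses) k ≡ localStep (run h) (just (i′ , v′) , tosses) k
    e = trans (ordinary (run h) k≢i) (sym (ordinary (run h) k≢i′))

  aimed-read : ∀ C k {j} → aim C k ≡ just j → readCount (perform C k (action C k)) ≡ 1
  aimed-read C k aimed with action C k
  ... | read _ _ _ = refl

  -- Only by reading can process k find out which of the two runs it is in.
  agree-or-read : ∀ {k g g′} n → Agree k (run g) (run g′) →
    Agree k (run (wait-for n g)) (run (wait-for n g′)) ⊎ tally k g ℕ.< tally k (wait-for n g)
  agree-or-read zero ag = inj₁ ag
  agree-or-read {k} {g} (suc n) ag with agree-or-read n ag
  ... | inj₂ lt = inj₂ (ℕ.≤-trans lt (ℕ.m≤m+n _ _))
  ... | inj₁ ag′ with just? (aim (run (wait-for n g)) k)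
  ...   | inj₂ quiet = inj₁ (agree-quiet ag′ quiet)
  ...   | inj₁ (j , aimed) = inj₂ (ℕ.≤-trans (s≤s (tally-mono k n g)) (ℕ.≤-reflexive
            (trans (sym (ℕ.+-comm _ 1)) (cong (tally k (wait-for n g) ℕ.+_) (sym (aimed-read (run (wait-for n g)) k aimed))))))

  wait-for-+ : ∀ m n g → wait-for (m ℕ.+ n) g ≡ wait-for m (wait-for n g)
  wait-for-+ zero    n g = refl
  wait-for-+ (suc m) n g = cong ((nothing , tosses) ∷_) (wait-for-+ m n g)

  inputs-wait : ∀ n g → inputs (wait-for n g) ≡ inputs g
  inputs-wait zero    g = refl
  inputs-wait (suc n) g = inputs-wait n g

  -- Each process is watched in a run of its own, since no single run notifies all three.
  Quiet : (Proc → History 0) → ℕ → Set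
  Quiet g t = ∀ k m → m ℕ.< t → aim (run (wait-for m (g k))) k ≡ nothing

  search : (f : Proc → Maybe Proc) → (∃₂ λ k j → f k ≡ just j) ⊎ (∀ k → f k ≡ nothing)
  search f with just? (f 0F) | just? (f 1F) | just? (f 2F)
  ... | inj₁ (j , e) | _            | _            = inj₁ (0F , j , e)
  ... | inj₂ _       | inj₁ (j , e) | _            = inj₁ (1F , j , e)
  ... | inj₂ _       | inj₂ _       | inj₁ (j , e) = inj₁ (2F , j , e)
  ... | inj₂ e₀      | inj₂ e₁      | inj₂ e₂      = inj₂ λ { 0F → e₀ ; 1F → e₁ ; 2F → e₂ }

  first-read : ∀ (g : Proc → History 0) n →
    (∃ λ t → Quiet g t × ∃₂ λ k j → aim (run (wait-for t (g k))) k ≡ just j) ⊎ Quiet g n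
  first-read g zero = inj₂ λ k m ()
  first-read g (suc n) with first-read g n
  ... | inj₁ found = inj₁ found
  ... | inj₂ quiet with search (λ k → aim (run (wait-for n (g k))) k)
  ...   | inj₁ found = inj₁ (n , quiet , found)
  ...   | inj₂ none  = inj₂ λ k m m<1+n → case-< k m (ℕ.m<1+n⇒m<n∨m≡n m<1+n)
    where
    case-< : ∀ k m → m ℕ.< n ⊎ m ≡ n → aim (run (wait-for m (g k))) k ≡ nothing
    case-< k m (inj₁ m<n)  = quiet k m m<n
    case-< k m (inj₂ refl) = none k

  quiet-agree : ∀ {k g g′} t → Agree k (run g) (run g′) →
    (∀ m → m ℕ.< t → aim (run (wait-for m g)) k ≡ nothing) →
    Agree k (run (wait-for t g)) (run (wait-for t g′))
  quiet-agree zero    ag quiet = ag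
  quiet-agree (suc t) ag quiet =
    agree-quiet (quiet-agree t ag λ m m<t → quiet m (ℕ.m<n⇒m<1+n m<t)) (quiet t ℕ.≤-refl)

  -- The two sequences end in different pairs, so one and the same register cannot be right in both
  -- runs.
  distinct : ∀ {k} h i n → Done (wait-for n (given h i 0)) → Done (wait-for n (given h i 1)) →
    ¬ Agree k (run (wait-for n (given h i 0))) (run (wait-for n (given h i 1)))
  distinct {k} h i n done₀ done₁ ag with List.∷ʳ-injectiveʳ (inputs h) (inputs h) (begin
    inputs h ∷ʳ (i , 0)                                ≡⟨ inputs-wait n (given h i 0) ⟨
    inputs (wait-for n (given h i 0))                  ≡⟨ done₀ k ⟨
    register (run (wait-for n (given h i 0))) k        ≡⟨ sameRegister ag ⟩
    register (run (wait-for n (given h i 1))) k        ≡⟨ done₁ k ⟩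
    inputs (wait-for n (given h i 1))                  ≡⟨ inputs-wait n (given h i 1) ⟩
    inputs h ∷ʳ (i , 1)                                ∎)
    where open ≡-Reasoning
  ... | ()

  Ready : Timing → History 0 → Set
  Ready τ h = Allowed τ A h × Done h

  may-input : ∀ τ {h} → Done h → MayInput τ A h
  may-input anytime    d = tt
  may-input sequential d = d

  allowed-wait : ∀ {τ} n {g} → Allowed τ A g → Allowed τ A (wait-for n g)
  allowed-wait zero    a = a
  allowed-wait (suc n) a = wait (allowed-wait n a)

  record Costly (τ : Timing) (h h′ : History 0) : Set where
    field
      ready   : Ready τ h′
      oneMore : opt (inputs h′) ≡ opt (inputs h) ℕ.+ 2
      dear    : cost h ℕ.+ 3 ℕ.≤ cost h′

  module Round {τ} (solves : Solves τ A) (h : History 0) (ready : Ready τ h) where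

    allowed-given : ∀ i v → Allowed τ A (given h i v)
    allowed-given i v = give (may-input τ (proj₂ ready)) (proj₁ ready)

    solved : ∀ i v → ∃ λ T → ∀ t → T ℕ.≤ t → Done (wait-for t (given h i v))
    solved i v = solves (given h i v) (allowed-given i v) (λ _ → tosses)

    time : Proc → ℕ
    -- The maximum ensures that the runs with the numbers 0 and 1 are both finished.
    time i = proj₁ (solved i 0) ℕ.⊔ proj₁ (solved i 1)

    done₀ : ∀ i {n} → time i ℕ.≤ n → Done (wait-for n (given h i 0))
    done₀ i {n} le = proj₂ (solved i 0) n (ℕ.≤-trans (ℕ.m≤m⊔n _ _) le)

    disagree : ∀ {k} i {n} → time i ℕ.≤ n →
      ¬ Agree k (run (wait-for n (given h i 0))) (run (wait-for n (given h i 1)))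
    disagree i {n} le = distinct h i n (done₀ i le) (proj₂ (solved i 1) n (ℕ.≤-trans (ℕ.m≤n⊔m _ _) le))

    -- A reference run: up to the first read of `k` it represents every run in which `k` is notified
    -- of an input after `h`.
    base : Proc → History 0
    base k = given h (other k) 0

    first : ∃ λ t → Quiet base t × ∃₂ λ k j → aim (run (wait-for t (base k))) k ≡ just j
    first with first-read base (time (other 0F))
    ... | inj₁ found = found
    -- Without any read, process 0 could not distinguish the numbers 0 and 1.
    ... | inj₂ quiet = ⊥-elim (disagree (other 0F) ℕ.≤-refl
            (quiet-agree (time (other 0F)) (agree-given h {0F} (other≢ 0F) (other≢ 0F)) (quiet 0F)))

    costly-round : ∃ (Costly τ h)
    costly-round with first
    ... | t , quiet , k , j , aimed = wait-for M (g 0) , record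
      { ready   = allowed-wait M (allowed-given i 0) , done₀ i (ℕ.m≤m+n (time i) (suc t))
      ; oneMore = trans (cong opt (inputs-wait M (g 0))) (opt-∷ʳ (inputs h) (i , 0))
      ; dear    = dear
      }
      where
      k≢j : k ≢ j
      k≢j = aimOf-≢ (action (run (wait-for t (base k))) k) aimed
      i = third k j
      k≢i = proj₁ (third≢ k j k≢j)
      j≢i = proj₂ (third≢ k j k≢j)
      -- The first `suc t` rounds include the first read of `k`; `time i` further rounds suffice for
      -- both runs to finish.
      M = time i ℕ.+ suc t
      g : ℕ → History 0
      g = given h i

      like-base : ∀ {p} v → p ≢ i → Agree p (run (wait-for t (base p))) (run (wait-for t (g v)))
      like-base {p} v p≢i = quiet-agree t (agree-given h (other≢ p) p≢i) (quiet p)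

      oblivious : ∀ {p} → p ≢ i → Agree p (run (wait-for t (g 0))) (run (wait-for t (g 1)))
      oblivious p≢i = Agree-trans (Agree-sym (like-base 0 p≢i)) (like-base 1 p≢i)

      aimed₀ : aim (run (wait-for t (g 0))) k ≡ just j
      aimed₀ = trans (sym (agree-aim (like-base 0 k≢i))) aimed

      -- Before round t process j has not read either, so the register that `k` reads has the same
      -- contents in both runs.
      still-oblivious : Agree k (run (wait-for (suc t) (g 0))) (run (wait-for (suc t) (g 1)))
      still-oblivious = agree-next (oblivious k≢i) λ j′ e →
        subst (λ j → register (run (wait-for t (g 0))) j ≡ register (run (wait-for t (g 1))) j)
          (Maybe.just-injective (trans (sym aimed₀) e)) (sameRegister (oblivious j≢i))

      at-least : ∀ p n → tally p h ℕ.≤ tally p (wait-for n (g 0))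
      at-least p n = ℕ.≤-trans (ℕ.m≤m+n _ _) (tally-mono p n (g 0))

      j-reads : tally j h ℕ.+ 1 ℕ.≤ tally j (wait-for M (g 0))
      j-reads with agree-or-read M (agree-given h j≢i j≢i)
      ... | inj₁ ag = ⊥-elim (disagree i (ℕ.m≤m+n (time i) (suc t)) ag)
      ... | inj₂ lt = ℕ.≤-trans (ℕ.≤-reflexive (ℕ.+-comm _ 1)) (ℕ.≤-trans (s≤s (at-least j 0)) lt)

      k-reads-first : tally k h ℕ.+ 1 ℕ.≤ tally k (wait-for (suc t) (g 0))
      k-reads-first = ℕ.+-mono-≤ (at-least k t)
        (ℕ.≤-reflexive (sym (aimed-read (run (wait-for t (g 0))) k aimed₀)))

      -- After its first read `k` still cannot tell the two runs apart, but its final registers in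
      -- them differ; so it reads again.
      k-reads : tally k h ℕ.+ 2 ℕ.≤ tally k (wait-for M (g 0))
      k-reads with agree-or-read (time i) still-oblivious
      ... | inj₁ ag = ⊥-elim (disagree i (ℕ.m≤m+n (time i) (suc t))
              (subst₂ (λ a b → Agree k (run a) (run b))
                (sym (wait-for-+ (time i) (suc t) (g 0))) (sym (wait-for-+ (time i) (suc t) (g 1))) ag))
      ... | inj₂ lt = ℕ.≤-trans (ℕ.≤-reflexive (ℕ.+-suc (tally k h) 1))
              (ℕ.≤-trans (s≤s k-reads-first)
                (subst (λ a → tally k (wait-for (suc t) (g 0)) ℕ.< tally k a) (sym (wait-for-+ (time i) (suc t) (g 0))) lt))

      dear : cost h ℕ.+ 3 ℕ.≤ cost (wait-for M (g 0))
      dear = begin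
        cost h ℕ.+ 3
          ≡⟨ cong (ℕ._+ 3) (trans (cost-tally h) (sum-split (λ p → tally p h) k j k≢j)) ⟩
        tally k h ℕ.+ (tally j h ℕ.+ tally i h) ℕ.+ 3
          ≡⟨ solve 3 (λ a b c → a :+ (b :+ c) :+ con 3
               := a :+ con 2 :+ (b :+ con 1 :+ c)) refl (tally k h) (tally j h) (tally i h) ⟩
        tally k h ℕ.+ 2 ℕ.+ (tally j h ℕ.+ 1 ℕ.+ tally i h)
          ≤⟨ ℕ.+-mono-≤ k-reads (ℕ.+-mono-≤ j-reads (at-least i M)) ⟩
        tally k h′ ℕ.+ (tally j h′ ℕ.+ tally i h′)
          ≡⟨ trans (cost-tally h′) (sum-split (λ p → tally p h′) k j k≢j) ⟨
        cost h′ ∎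
        where
        open ℕ.≤-Reasoning
        open ℕ.+-*-Solver
        h′ = wait-for M (g 0)

  module _ {τ} (solves : Solves τ A) where

    -- A costly round ends ready for the next input, so such rounds can be chained: each adds 3
    -- reads against an offline cost of 2.
    costly-history : ∀ n → ∃ λ h → Ready τ h × opt (inputs h) ≡ n ℕ.* 2 × n ℕ.* 3 ℕ.≤ cost h
    costly-history zero with solves [] start (λ _ → tosses)
    ... | T , done = wait-for T [] , (allowed-wait T start , done T ℕ.≤-refl) , cong opt (inputs-wait T []) , z≤n
    costly-history (suc n) with costly-history n
    ... | h , ready , o , d with Round.costly-round solves h ready
    ...   | h′ , c = h′ , Costly.ready c
            , trans (Costly.oneMore c) (trans (ℕ.+-comm _ 2) (cong (2 ℕ.+_) o))
            , ℕ.≤-trans (ℕ.≤-trans (ℕ.≤-reflexive (ℕ.+-comm 3 (n ℕ.* 3))) (ℕ.+-monoˡ-≤ 3 d)) (Costly.dear c)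

-- The Archimedean property and the contradiction for ratios below 3/2.

i≤∣i∣ : ∀ i → i ℤ.≤ + ℤ.∣ i ∣
i≤∣i∣ (+ n)      = ℤ.≤-refl
i≤∣i∣ ℤ.-[1+ n ] = ℤ.-≤+

-- A denominator is at least 1, so a rational is at most the absolute value of its numerator.
below-numerator : ∀ p → p < fromℕ (suc ℤ.∣ ↥ p ∣)
below-numerator p@record{} = toℚᵘ-cancel-< (ℚᵘ.<-respʳ-≃ (ℚᵘ.≃-sym (fromℕ-unnormalised N)) (ℚᵘ.*<* (begin-strict
  ↥ p ℤ.* + 1            ≡⟨ ℤ.*-identityʳ (↥ p) ⟩
  ↥ p                    ≤⟨ i≤∣i∣ (↥ p) ⟩
  + ℤ.∣ ↥ p ∣            <⟨ ℤ.+<+ (ℕ.n<1+n _) ⟩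
  + N                    ≤⟨ ℤ.+≤+ (ℕ.m≤m*n N (↧ₙ p)) ⟩
  + (N ℕ.* ↧ₙ p)         ≡⟨ ℤ.pos-* N (↧ₙ p) ⟩
  + N ℤ.* ↧ p            ∎)))
  where
  open ℤ.≤-Reasoning
  N = suc ℤ.∣ ↥ p ∣

archimedean : ∀ ε α → 0ℚ < ε → ∃ λ n → α < fromℕ n * ε
archimedean ε α 0<ε = suc ℤ.∣ ↥ q ∣ , (begin-strict
  α                             ≡⟨ *-identityʳ α ⟨
  α * 1ℚ                        ≡⟨ cong (α *_) (*-inverseˡ ε) ⟨
  α * (1/ ε * ε)                ≡⟨ *-assoc α (1/ ε) ε ⟨
  q * ε                         <⟨ *-monoˡ-<-pos ε (below-numerator q) ⟩
  fromℕ (suc ℤ.∣ ↥ q ∣) * ε     ∎)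
  where
  open ≤-Reasoning
  instance
    ε-positive : Positive ε
    ε-positive = positive 0<ε
    ε-nonZero : NonZero ε
    ε-nonZero = pos⇒nonZero ε
  q = α * 1/ ε

rearrange : ∀ n t c d α → n * t ≤ c * (n * d) + α → n * (t - c * d) ≤ α
rearrange n t c d α le = begin
  n * (t - c * d)                 ≡⟨ solve 4 (λ n t c d → n :* (t :- c :* d) := n :* t :- c :* (n :* d))
       refl n t c d ⟩
  n * t - c * (n * d)             ≤⟨ +-monoˡ-≤ (- (c * (n * d))) le ⟩
  c * (n * d) + α - c * (n * d)   ≡⟨ solve 2 (λ x a → x :+ a :- x := a) refl (c * (n * d)) α ⟩
  α                               ∎
  where
  open ≤-Reasoning
  open +-*-Solver

gap-positive : ∀ c → c < (+ 3 / 2) → 0ℚ < fromℕ 3 - c * fromℕ 2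
gap-positive c c<3/2 = begin-strict
  0ℚ                        ≡⟨ +-inverseʳ (c * fromℕ 2) ⟨
  c * fromℕ 2 - c * fromℕ 2 <⟨ +-monoˡ-< (- (c * fromℕ 2)) (*-monoˡ-<-pos (fromℕ 2) c<3/2) ⟩
  fromℕ 3 - c * fromℕ 2     ∎
  where open ≤-Reasoning

deterministic-bound : ∀ τ (A : DeterministicAlgorithm) → Solves τ A → ∀ c → c < (+ 3 / 2) →
  ¬ DeterministicallyCompetitive τ A c
deterministic-bound τ A solves c c<3/2 (α , competitive) = exceeded (LowerBound.costly-history A solves n)
  where
  large : ∃ λ n → α < fromℕ n * (fromℕ 3 - c * fromℕ 2)
  -- Each costly round exceeds c times its offline cost by 3 - 2c, and n rounds of this surplus
  -- outgrow the additive constant.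
  large = archimedean (fromℕ 3 - c * fromℕ 2) α (gap-positive c c<3/2)
  n : ℕ
  n = proj₁ large
  exceeded : ¬ ∃ λ h → LowerBound.Ready A τ h × opt (inputs h) ≡ n ℕ.* 2 × n ℕ.* 3 ℕ.≤ Execution.cost A h
  exceeded (h , (allowed , _) , o , d) = <-irrefl refl (<-≤-trans (proj₂ large)
    (rearrange (fromℕ n) (fromℕ 3) c (fromℕ 2) α
      (subst₂ (λ x y → x ≤ c * y + α) (fromℕ-* n 3) (trans (cong fromℕ o) (fromℕ-* n 2))
        (≤-trans (fromℕ-mono d) (competitive h allowed)))))

theorem1 : (τ : Timing) →
    (Σ ℕ λ k → Σ (Algorithm k) λ A → Solves τ A × CompetitiveInExpectation τ A (+ 23 / 16))
    ×
    ((A : DeterministicAlgorithm) → Solves τ A → (c : ℚ) → c < (+ 3 / 2) → ¬ DeterministicallyCompetitive τ A c)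
theorem1 τ = (1 , hub , hub-solves τ , hub-competitive τ) , deterministic-bound τ
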